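{- Some $n$-vertex graphs of treewidth $\tau$ require $\Omega(n\tau)$ voxels. Precisely: there is a constant $c>0$ such that for every integer $\tau\ge 1$ there are arbitrarily large integers $n$ for which there exists a graph $G$ with $n$ vertices and treewidth $\tau$ such that every voxel representation of $G$ has size at least $c\,n\,\tau$.
   Context: All graphs are finite and simple. A voxel is a cell of the unit cube grid in 3-dimensional space; two distinct voxels are adjacent if they share a face. A blob is a nonempty finite set of voxels that is connected with respect to this adjacency. A voxel representation of a graph $G=(V,E)$ assigns to each vertex $v\in V$ a blob $B_v$ such that the blobs of distinct vertices are disjoint and, for all distinct $u,v\in V$, some voxel of $B_u$ is adjacent to some voxel of $B_v$ if and only if $uv\in E$. Its size is $\sum_{v\in V}|B_v|$. Treewidth is the usual notion: the minimum, over all tree decompositions, of the maximum bag size minus $1$. -}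

module Defs where

open import Data.Fin.Base using (Fin)
open import Data.Fin.Subset using (Subset; ∣_∣) renaming (_∈_ to _∈ˢ_)
open import Data.Integer.Base as ℤ using (ℤ; +_)
open import Data.List.Base using (List; []; _∷_; _∷ʳ_; length; tabulate)
open import Data.List.Extrema.Nat using (max)
open import Data.List.Membership.Propositional using (_∈_)
open import Data.List.Relation.Binary.Disjoint.Propositional using (Disjoint)
open import Data.List.Relation.Unary.Linked using (Linked)
open import Data.List.Relation.Unary.Unique.Propositional using (Unique)
open import Data.Nat.Base using (ℕ; _∸_; _≤_; NonZero)
open import Data.Nat.ListAction using (sum)
open import Data.Product.Base using (Σ-syntax; ∃-syntax; _×_; _,_)
open import Data.Rational.Base as ℚ using (ℚ)
open import Data.Vec.Base using (Vec; _[_]%=_)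
open import Function.Bundles using (_⇔_)
open import Level using (0ℓ)
open import Relation.Binary.Construct.Closure.ReflexiveTransitive using (Star)
open import Relation.Binary.Core using (Rel)
open import Relation.Binary.Definitions using (Decidable; Irreflexive; Symmetric)
open import Relation.Binary.PropositionalEquality.Core using (_≡_; _≢_)
open import Relation.Nullary.Negation.Core using (¬_)
open import Relation.Unary using (Pred; U)

-- Any two elements of P are joined by an R-path that stays inside P.
-- The empty set is connected in this sense, so nonemptiness is required
-- separately where it matters.
Connected : {A : Set} → Rel A 0ℓ → Pred A 0ℓ → Set
Connected R P = ∀ {x y} → P x → P y → Star (λ a b → P a × P b × R a b) x y

record Graph (n : ℕ) : Set₁ where
  field
    Adj    : Rel (Fin n) 0ℓ
    adj?   : Decidable Adj
    sym    : Symmetric Adj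
    irrefl : Irreflexive _≡_ Adj

open Graph public using (Adj)

-- The closed walk start, rest, start; two further vertices make its
-- length at least 3.
record Cycle {n : ℕ} (G : Graph n) : Set where
  field
    start    : Fin n
    rest     : List (Fin n)
    long     : 2 ≤ length rest
    distinct : Unique (start ∷ rest)
    closed   : Linked (Adj G) (start ∷ rest ∷ʳ start)

record IsTree {n : ℕ} (T : Graph n) : Set where
  field
    nonempty  : NonZero n
    connected : Connected (Adj T) U
    acyclic   : ¬ Cycle T

record TreeDecomposition {n : ℕ} (G : Graph n) : Set₁ where
  field
    nodes     : ℕ
    tree      : Graph nodes
    isTree    : IsTree tree
    bag       : Fin nodes → Subset n
    vertices  : ∀ v → ∃[ t ] v ∈ˢ bag t
    edges     : ∀ {u v} → Adj G u v → ∃[ t ] u ∈ˢ bag t × v ∈ˢ bag t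
    connected : ∀ v → Connected (Adj tree) (λ t → v ∈ˢ bag t)

  -- Truncated subtraction matters only for the graph with no vertices:
  -- otherwise some bag is nonempty.
  width : ℕ
  width = max 0 (tabulate (λ t → ∣ bag t ∣)) ∸ 1

open TreeDecomposition public using (width)

HasTreewidth : {n : ℕ} → Graph n → ℕ → Set₁
HasTreewidth G k =
  (Σ[ D ∈ TreeDecomposition G ] width D ≡ k) ×
  ((D : TreeDecomposition G) → k ≤ width D)

-- A voxel is represented by its corner with the least coordinates.
Voxel : Set
Voxel = Vec ℤ 3

-- (i , p) is the face of the voxel p that is orthogonal to axis i and
-- contains the corner p.
Face : Set
Face = Fin 3 × Vec ℤ 3

data _isFaceOf_ : Face → Voxel → Set where
  lower : ∀ i p → (i , p) isFaceOf p
  upper : ∀ i p → (i , p [ i ]%= ℤ.suc) isFaceOf p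

_adjacent_ : Rel Voxel 0ℓ
p adjacent q = p ≢ q × ∃[ f ] f isFaceOf p × f isFaceOf q

-- The finite set of voxels is listed without repetition, so its
-- cardinality is the length of the list.
record Blob : Set where
  field
    voxels    : List Voxel
    unique    : Unique voxels
    nonempty  : voxels ≢ []
    connected : Connected _adjacent_ (_∈ voxels)

open Blob public using (voxels)

_touches_ : Rel Blob 0ℓ
B touches C = ∃[ p ] ∃[ q ] p ∈ voxels B × q ∈ voxels C × p adjacent q

record VoxelRepresentation {n : ℕ} (G : Graph n) : Set where
  field
    blob     : Fin n → Blob
    disjoint : ∀ {u v} → u ≢ v → Disjoint (voxels (blob u)) (voxels (blob v))
    contacts : ∀ {u v} → u ≢ v → (blob u touches blob v) ⇔ Adj G u v

  size : ℕ
  size = sum (tabulate (λ v → length (voxels (blob v))))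

open VoxelRepresentation public using (size)

fromℕ : ℕ → ℚ
fromℕ k = + k ℚ./ 1

{-# OPTIONS --safe #-}
-- G is a disjoint union of cliques on τ + 1 vertices. A voxel has only six
-- neighbours, so a blob with τ neighbouring blobs has at least τ / 6 voxels.
-- For the treewidth, suppose that no bag contains a given clique. Then every
-- node t misses some clique vertex v, and the nodes of v all lie behind a
-- single neighbour f t of t. In a finite tree some edge has f t = s and
-- f s = t; two clique vertices then live on opposite sides of the edge st,
-- although some bag contains both.
module Submission where

open import Defs
open import Data.Bool.Base using (true)
open import Data.Empty using (⊥; ⊥-elim)
open import Data.Fin.Base
  using (Fin; zero; suc; combine; remQuot; quotient; remainder; punchIn; splitAt; toℕ)
open import Data.Fin.Properties
  using (_≟_; any?; pigeonhole; injective⇒≤; combine-injectiveʳ; remQuot-combine;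
         punchIn-injective; punchInᵢ≢i)
open import Data.Fin.Subset as Subset
  using (Subset; inside; outside; ∣_∣; _⊆_) renaming (_∈_ to _∈ˢ_; _∉_ to _∉ˢ_)
open import Data.Fin.Subset.Properties using (_∈?_; _⊆?_; ∣⊥∣≡0; ∣⊤∣≡n; p⊆q⇒∣p∣≤∣q∣)
import Data.Integer.Base as ℤ
import Data.Integer.Properties as ℤ
open import Data.List.Base using (List; []; _∷_; _∷ʳ_; length; tabulate; lookup)
open import Data.List.Extrema.Nat using (max; xs≤max; max≤v⁺)
open import Data.List.Membership.Propositional using (_∈_)
import Data.List.Membership.DecPropositional as DecMembership
open import Data.List.Relation.Unary.All using ([]; _∷_)
import Data.List.Relation.Unary.All.Properties as All
open import Data.List.Relation.Unary.Any using (here; there; index)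
open import Data.List.Relation.Unary.Any.Properties using (lookup-index)
open import Data.List.Relation.Unary.AllPairs using ([]; _∷_)
open import Data.List.Relation.Unary.Linked using (Linked; [-]; _∷_)
open import Data.List.Relation.Unary.Unique.Propositional using (Unique)
open import Data.Nat.Base using (ℕ; zero; suc; _+_; _*_; _≤_; z≤n; s≤s; NonZero)
open import Data.Nat.GeneralisedArithmetic using (iterate)
open import Data.Nat.ListAction using (sum)
import Data.Nat.Properties as ℕ
open import Data.Product.Base using (Σ-syntax; ∃-syntax; _×_; _,_; proj₁; proj₂)
open import Data.Rational.Base as ℚ using (ℚ; 0ℚ)
import Data.Rational.Properties as ℚ
import Data.Rational.Unnormalised.Base as ℚᵘ
import Data.Rational.Unnormalised.Properties as ℚᵘ
open import Data.Sum.Base using (_⊎_; inj₁; inj₂)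
open import Data.Unit.Base using (⊤; tt)
open import Data.Vec.Base as Vec using (_++_; _[_]%=_)
import Data.Vec.Properties as Vec
open import Function.Base using (_∘_)
open import Function.Bundles using (Equivalence)
open import Level using (0ℓ)
open import Relation.Binary.Construct.Closure.ReflexiveTransitive as Star
  using (Star; ε; _◅_; _◅◅_)
open import Relation.Binary.Core using (Rel)
open import Relation.Binary.Definitions using (DecidableEquality)
open import Relation.Binary.PropositionalEquality
  using (_≡_; _≢_; refl; sym; trans; cong; cong₂; subst; module ≡-Reasoning)
open import Relation.Nullary.Decidable
  using (Dec; yes; no; does; ¬?; _×-dec_; dec-true)
open import Relation.Nullary.Negation.Core using (¬_; contradiction)

-- Trees

-- The list omits the first vertex, so `x ∷ l` is the vertex sequence in the form that `Cycle` uses.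
data Path {A : Set} (R : Rel A 0ℓ) : A → A → List A → Set where
  []  : ∀ {x} → Path R x x []
  _∷_ : ∀ {x y z l} → R x z → Path R z y l → Path R x y (z ∷ l)

module _ {A : Set} {R : Rel A 0ℓ} where

  path-suffix : ∀ {x y z l} → Path R z y l → Unique (z ∷ l) → x ∈ z ∷ l →
                ∃[ l′ ] Path R x y l′ × Unique (x ∷ l′)
  path-suffix p       u       (here refl) = _ , p , u
  path-suffix (_ ∷ p) (_ ∷ u) (there x∈l) = path-suffix p u x∈l

  path-closes : ∀ {S : Rel A 0ℓ} {x y z l} → (∀ {a b} → R a b → S a b) →
                Path R x y l → S y z → Linked S (x ∷ l ∷ʳ z)
  path-closes R⇒S []      s = s ∷ [-]
  path-closes R⇒S (r ∷ p) s = R⇒S r ∷ path-closes R⇒S p s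

  module _ (_≟ᴬ_ : DecidableEquality A) where
    open DecMembership _≟ᴬ_ using () renaming (_∈?_ to _∈ᴸ?_)

    -- Simplify the tail first; if its path already visits `x`, keep only the part from that visit
    -- on.
    loop-erasure : ∀ {x y} → Star R x y → ∃[ l ] Path R x y l × Unique (x ∷ l)
    loop-erasure ε = [] , [] , [] ∷ []
    loop-erasure {x} (_◅_ {j = z} r w) with loop-erasure w
    ... | l , p , u with x ∈ᴸ? (z ∷ l)
    ...   | yes x∈ = path-suffix p u x∈
    ...   | no  x∉ = z ∷ l , r ∷ p , All.¬Any⇒All¬ _ x∉ ∷ u

    -- A departure found in the tail is the later one and is kept. Otherwise the tail avoids `t`,
    -- and the first step is the last departure exactly when it starts at `t`.
    last-departure : ∀ {t a x} → x ≢ t → Star R a x →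
      (∃[ s ] R t s × Star (λ b c → R b c × b ≢ t × c ≢ t) s x) ⊎
      (a ≢ t × Star (λ b c → R b c × b ≢ t × c ≢ t) a x)
    last-departure x≢t ε = inj₂ (x≢t , ε)
    last-departure {t} {a} x≢t (r ◅ w) with last-departure x≢t w
    ... | inj₁ found = inj₁ found
    ... | inj₂ (b≢t , w′) with a ≟ᴬ t
    ...   | yes refl = inj₁ (_ , r , w′)
    ...   | no  a≢t  = inj₂ (a≢t , (r , a≢t , b≢t) ◅ w′)

module _ {m : ℕ} {T : Graph m} (isTree : IsTree T) where
  open IsTree isTree

  -- The oriented edge (s , t) is enough to forbid: a simple walk from s to t
  -- cannot use (t , s).
  edge-is-bridge : ∀ {s t} → Adj T s t →
                   ¬ Star (λ a b → Adj T a b × ¬ (a ≡ s × b ≡ t)) s t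
  edge-is-bridge {s} st w with loop-erasure _≟_ w
  ... | _ , []                , _ = Graph.irrefl T refl st
  ... | _ , (_ , avoids) ∷ [] , _ = avoids (refl , refl)
  ... | _ , p@(_ ∷ _ ∷ _)     , u = acyclic record
    { start    = s
    ; rest     = _
    ; long     = s≤s (s≤s z≤n)
    ; distinct = u
    ; closed   = path-closes proj₁ p (Graph.sym T st)
    }

  -- For `s ≢ t` this is the component of `s` after deletion of the node `t`.
  Behind : Fin m → Fin m → Fin m → Set
  Behind t s = Star (λ a b → Adj T a b × a ≢ t × b ≢ t) s

  -- The walk from `s` to `x`, followed by the reversed walk from `x` to `t`, would bypass the
  -- bridge: the first half never enters `t`, the second never leaves from `s`.
  sides-disjoint : ∀ {s t x} → Adj T s t → Behind t s x → ¬ Behind s t x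
  sides-disjoint st w w′ = edge-is-bridge st
    (Star.map (λ { (r , _ , b≢t) → r , λ { (_ , b≡t) → b≢t b≡t } }) w ◅◅
     Star.reverse (λ { (r , a≢s , b≢s) → Graph.sym T r , λ { (b≡s , _) → b≢s b≡s } }) w′)

  module _ (f : Fin m → Fin m) where

    orbit-walk : ∀ k x → Star (λ a b → b ≡ f a) x (iterate f x k)
    orbit-walk zero    x = ε
    orbit-walk (suc k) x = refl ◅ orbit-walk k (f x)

    iterate-+ : ∀ j k x → iterate f x (j + k) ≡ iterate f (iterate f x j) k
    iterate-+ zero    k x = refl
    iterate-+ (suc j) k x = iterate-+ j k (f x)

    periodic-point : Fin m → ∃[ x ] ∃[ k ] iterate f (f x) k ≡ x
    -- Among the first `m + 1` iterates two agree, at `i < j`. Writing `j = 1 + i + k` makes the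
    -- period `1 + k` visibly positive.
    periodic-point x₀ with pigeonhole (ℕ.n<1+n m) (iterate f x₀ ∘ toℕ)
    ... | i , j , i<j , eq with ℕ.m≤n⇒∃[o]m+o≡n i<j
    ...   | k , 1+i+k≡j = iterate f x₀ (toℕ i) , k , (begin
      iterate f (iterate f x₀ (toℕ i)) (suc k) ≡⟨ iterate-+ (toℕ i) (suc k) x₀ ⟨
      iterate f x₀ (toℕ i + suc k)             ≡⟨ cong (iterate f x₀) (ℕ.+-suc (toℕ i) k) ⟩
      iterate f x₀ (suc (toℕ i + k))           ≡⟨ cong (iterate f x₀) 1+i+k≡j ⟩
      iterate f x₀ (toℕ j)                     ≡⟨ eq ⟨
      iterate f x₀ (toℕ i)                     ∎)
      where open ≡-Reasoning

    -- Otherwise the orbit of a periodic point x would return from f x to x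
    -- without the edge between them.
    reversed-edge : (∀ t → Adj T t (f t)) → Fin m → ∃[ t ] f (f t) ≡ t
    reversed-edge adj x₀ with periodic-point x₀
    ... | x , k , period with f (f x) ≟ x
    ...   | yes eq = x , eq
    ...   | no neq = contradiction
      (subst (Star _ (f x)) period
        (Star.map (λ { {a} refl → adj a , λ { (refl , eq) → neq eq } }) (orbit-walk k (f x))))
      (edge-is-bridge (Graph.sym T (adj x)))

-- Treewidth

⊈⇒missing : ∀ {n} {p q : Subset n} → ¬ (p ⊆ q) → ∃[ v ] v ∈ˢ p × v ∉ˢ q
⊈⇒missing {p = p} {q} p⊈q with any? (λ v → (v ∈? p) ×-dec ¬? (v ∈? q))
... | yes found = found
... | no  none  = ⊥-elim (p⊈q (λ {x} → p⊆q {x}))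
  where
  p⊆q : p ⊆ q
  p⊆q {x} x∈p with x ∈? q
  ... | yes x∈q = x∈q
  ... | no  x∉q = contradiction (x , x∈p , x∉q) none

module _ {n : ℕ} {G : Graph n} (D : TreeDecomposition G) where
  open TreeDecomposition D hiding (width)

  -- Truncation is harmless here: `a ≤ 1 + (a ∸ 1)` also holds for `a = 0`.
  bag≤1+width : ∀ t → ∣ bag t ∣ ≤ suc (width D)
  bag≤1+width t = ℕ.≤-trans
    (All.tabulate⁻ (xs≤max 0 (tabulate (∣_∣ ∘ bag))) t)
    (ℕ.m≤n+m∸n _ 1)

  -- The nodes of `v` form a connected set that avoids `t`, so they share one component of the tree
  -- without `t`. A walk from `t` to any of them finds `s` at its last departure from `t`.
  nodes-behind-neighbour : ∀ {t v} → v ∉ˢ bag t →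
    ∃[ s ] Adj tree t s × (∀ {x} → v ∈ˢ bag x → Behind isTree t s x)
  nodes-behind-neighbour {t} {v} v∉t = go
    where
    avoids : ∀ {x} → v ∈ˢ bag x → x ≢ t
    avoids v∈x refl = v∉t v∈x

    go : ∃[ s ] Adj tree t s × (∀ {x} → v ∈ˢ bag x → Behind isTree t s x)
    go with vertices v
    ... | y , v∈y with last-departure _≟_ (avoids v∈y)
                         (Star.map (λ { (_ , _ , r) → r }) (IsTree.connected isTree {t} {y} tt tt))
    ...   | inj₂ (t≢t , _)   = contradiction refl t≢t
    ...   | inj₁ (s , r , w) = s , r , λ v∈x →
      w ◅◅ Star.map (λ { (v∈a , v∈b , ab) → ab , avoids v∈a , avoids v∈b }) (connected v v∈y v∈x)

  clique⊆bag : (K : Subset n) → (∀ {u v} → u ∈ˢ K → v ∈ˢ K → u ≢ v → Adj G u v) →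
               ∃[ t ] K ⊆ bag t
  clique⊆bag K clique with any? (λ t → K ⊆? bag t)
  ... | yes found = found
  ... | no  none  = ⊥-elim (opposite-sides
    (reversed-edge isTree next (proj₁ ∘ proj₂ ∘ side) (some-node (IsTree.nonempty isTree))))
    where
    missing : ∀ t → ∃[ v ] v ∈ˢ K × v ∉ˢ bag t
    missing t = ⊈⇒missing (λ K⊆t → none (t , λ {x} → K⊆t {x}))

    side : ∀ t → ∃[ s ] Adj tree t s ×
                 (∀ {x} → proj₁ (missing t) ∈ˢ bag x → Behind isTree t s x)
    side t = nodes-behind-neighbour (proj₂ (proj₂ (missing t)))

    next : Fin nodes → Fin nodes
    next = proj₁ ∘ side

    common-bag : ∀ {u v} → u ∈ˢ K → v ∈ˢ K → ∃[ t ] u ∈ˢ bag t × v ∈ˢ bag t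
    common-bag {u} {v} u∈K v∈K with u ≟ v
    ... | no u≢v = edges (clique u∈K v∈K u≢v)
    -- The vertices missing from two different bags may coincide; then no edge is available, and any
    -- bag of that vertex serves.
    ... | yes refl with vertices u
    ...   | t , u∈t = t , u∈t , u∈t

    some-node : ∀ {k} → NonZero k → Fin k
    some-node {suc _} _ = zero

    opposite-sides : ¬ (∃[ t ] next (next t) ≡ t)
    -- The bag of `x` holds the vertices missing at `t` and at `next t`, so `x` would lie on both
    -- sides of the edge between these nodes.
    opposite-sides (t , nnt≡t) = sides-disjoint isTree
      (Graph.sym tree (proj₁ (proj₂ (side t))))
      (proj₂ (proj₂ (side t)) v∈x)
      (subst (λ r → Behind isTree (next t) r x) nnt≡t (proj₂ (proj₂ (side (next t))) w∈x))
      where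
      common = common-bag (proj₁ (proj₂ (missing t))) (proj₁ (proj₂ (missing (next t))))
      x   = proj₁ common
      v∈x = proj₁ (proj₂ common)
      w∈x = proj₂ (proj₂ common)

-- The disjoint union of cliques

-- The shape of the decomposition, with one node per clique; the hub `zero` carries a clique too.
starTree : ∀ m → Graph (suc m)
starTree m = record
  { Adj    = _~_
  ; adj?   = _~?_
  ; sym    = λ {x} {y} → ~-sym x y
  ; irrefl = λ { {x} refl → ~-irrefl x }
  }
  where
  _~_ : Rel (Fin (suc m)) 0ℓ
  zero  ~ zero  = ⊥
  zero  ~ suc _ = ⊤
  suc _ ~ zero  = ⊤
  suc _ ~ suc _ = ⊥

  _~?_ : ∀ x y → Dec (x ~ y)
  zero  ~? zero  = no λ ()
  zero  ~? suc _ = yes tt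
  suc _ ~? zero  = yes tt
  suc _ ~? suc _ = no λ ()

  ~-sym : ∀ x y → x ~ y → y ~ x
  ~-sym zero    (suc _) _ = tt
  ~-sym (suc _) zero    _ = tt

  ~-irrefl : ∀ x → ¬ (x ~ x)
  ~-irrefl zero    ()
  ~-irrefl (suc _) ()

starTree-isTree : ∀ m → IsTree (starTree m)
starTree-isTree m = record
  { nonempty  = _
  ; connected = λ {x} {y} _ _ → to-hub x ◅◅ from-hub y
  ; acyclic   = λ C → no-cycle (Cycle.long C) (Cycle.distinct C) (Cycle.closed C)
  }
  where
  _⟶_ : Rel (Fin (suc m)) 0ℓ
  a ⟶ b = ⊤ × ⊤ × Adj (starTree m) a b

  to-hub : ∀ x → Star _⟶_ x zero
  to-hub zero    = ε
  to-hub (suc _) = (tt , tt , tt) ◅ ε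

  from-hub : ∀ x → Star _⟶_ zero x
  from-hub zero    = ε
  from-hub (suc _) = (tt , tt , tt) ◅ ε

  -- Edges alternate between hub and leaves, so a closed walk on at least three vertices either
  -- repeats the hub or contains a forbidden step.
  no-cycle : ∀ {x l} → 2 ≤ length l → Unique (x ∷ l) → ¬ Linked (Adj (starTree m)) (x ∷ l ∷ʳ x)
  no-cycle {zero}  {suc _ ∷ zero ∷ _}          _ ((_ ∷ 0≢0 ∷ _) ∷ _)       _ = 0≢0 refl
  no-cycle {zero}  {suc _ ∷ suc _ ∷ _}         _ _ (_ ∷ () ∷ _)
  no-cycle {zero}  {zero ∷ _}                  _ _ (() ∷ _)
  no-cycle {suc _} {suc _ ∷ _}                 _ _ (() ∷ _)
  no-cycle {suc _} {zero ∷ zero ∷ _}           _ _ (_ ∷ () ∷ _)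
  no-cycle {suc _} {zero ∷ suc _ ∷ []}         _ _ (_ ∷ _ ∷ () ∷ _)
  no-cycle {suc _} {zero ∷ suc _ ∷ zero ∷ _}   _ (_ ∷ (_ ∷ 0≢0 ∷ _) ∷ _)   _ = 0≢0 refl
  no-cycle {suc _} {zero ∷ suc _ ∷ suc _ ∷ _}  _ _ (_ ∷ _ ∷ () ∷ _)
  no-cycle {_}     {_ ∷ []} (s≤s ())

∣p++q∣≡∣p∣+∣q∣ : ∀ {m n} (p : Subset m) (q : Subset n) → ∣ p ++ q ∣ ≡ ∣ p ∣ + ∣ q ∣
∣p++q∣≡∣p∣+∣q∣ Vec.[]               q = refl
∣p++q∣≡∣p∣+∣q∣ (inside  Vec.∷ p) q = cong suc (∣p++q∣≡∣p∣+∣q∣ p q)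
∣p++q∣≡∣p∣+∣q∣ (outside Vec.∷ p) q = ∣p++q∣≡∣p∣+∣q∣ p q

-- The fibre of `quotient k` over `i`, laid out as `k` consecutive positions so that its size
-- follows by recursion.
block : ∀ {m} k → Fin m → Subset (m * k)
block k zero    = Subset.⊤ {k} ++ Subset.⊥
block k (suc i) = Subset.⊥ {k} ++ block k i

∣block∣≡k : ∀ {m} k (i : Fin m) → ∣ block k i ∣ ≡ k
∣block∣≡k {suc m} k zero = begin
  ∣ Subset.⊤ {k} ++ Subset.⊥ {m * k} ∣        ≡⟨ ∣p++q∣≡∣p∣+∣q∣ (Subset.⊤ {k}) Subset.⊥ ⟩
  ∣ Subset.⊤ {k} ∣ + ∣ Subset.⊥ {m * k} ∣     ≡⟨ cong₂ _+_ (∣⊤∣≡n k) (∣⊥∣≡0 (m * k)) ⟩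
  k + 0                                        ≡⟨ ℕ.+-identityʳ k ⟩
  k                                            ∎
  where open ≡-Reasoning
∣block∣≡k k (suc i) =
  trans (∣p++q∣≡∣p∣+∣q∣ (Subset.⊥ {k}) _) (cong₂ _+_ (∣⊥∣≡0 k) (∣block∣≡k k i))

-- Both sides recurse by splitting off the first `k` positions.
lookup-block : ∀ {m} k (i : Fin m) v → Vec.lookup (block k i) v ≡ does (quotient {m} k v ≟ i)
lookup-block {suc m} k zero v
  rewrite Vec.lookup-splitAt k (Subset.⊤ {k}) (Subset.⊥ {m * k}) v with splitAt k v
... | inj₁ j = Vec.lookup-replicate j inside
... | inj₂ j = Vec.lookup-replicate j outside
lookup-block {suc m} k (suc i) v
  rewrite Vec.lookup-splitAt k (Subset.⊥ {k}) (block k i) v with splitAt k v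
... | inj₁ j = Vec.lookup-replicate j outside
... | inj₂ j = lookup-block k i j

does⇒ : {P : Set} (P? : Dec P) → does P? ≡ true → P
does⇒ (yes p) _ = p

module _ {m k : ℕ} where

  ∈-block⁺ : ∀ v → v ∈ˢ block {m} k (quotient k v)
  ∈-block⁺ v = Vec.lookup⇒[]= v _ (trans (lookup-block k q v) (dec-true (q ≟ q) refl))
    where q = quotient {m} k v

  ∈-block⁻ : ∀ (i : Fin m) v → v ∈ˢ block k i → quotient k v ≡ i
  ∈-block⁻ i v v∈ = does⇒ (quotient {m} k v ≟ i)
    (trans (sym (lookup-block k i v)) (Vec.[]=⇒lookup v∈))

  cliques : Graph (m * k)
  cliques = record
    { Adj    = λ u v → u ≢ v × quotient {m} k u ≡ quotient k v
    ; adj?   = λ u v → ¬? (u ≟ v) ×-dec (quotient k u ≟ quotient k v)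
    ; sym    = λ { (u≢v , eq) → u≢v ∘ sym , sym eq }
    ; irrefl = λ { refl (u≢u , _) → u≢u refl }
    }

  -- `punchIn` skips the position of `v` in its clique, so `j` enumerates the other `k` members.
  clique-neighbour : Fin (m * suc k) → Fin k → Fin (m * suc k)
  clique-neighbour v j = combine {m} (quotient (suc k) v) (punchIn (remainder {m} (suc k) v) j)

  clique-neighbour-injective : ∀ v {i j} → clique-neighbour v i ≡ clique-neighbour v j → i ≡ j
  clique-neighbour-injective v {i} {j} eq =
    punchIn-injective (remainder {m} (suc k) v) i j (combine-injectiveʳ {m} q _ q _ eq)
    where q = quotient {m} (suc k) v

cliques-adj : ∀ {m k} v (j : Fin k) → Adj (cliques {m} {suc k}) v (clique-neighbour {m} v j)
cliques-adj {m} {k} v j = v≢w , sym (cong proj₁ split)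
  where
  split : remQuot {m} (suc k) (clique-neighbour {m} v j) ≡
          (quotient (suc k) v , punchIn (remainder {m} (suc k) v) j)
  split = remQuot-combine {m} {suc k} _ _

  v≢w : v ≢ clique-neighbour {m} v j
  v≢w eq = punchInᵢ≢i (remainder {m} (suc k) v) j
    (sym (trans (cong (remainder {m} (suc k)) eq) (cong proj₂ split)))

cliques-decomposition : ∀ m k → TreeDecomposition (cliques {suc m} {k})
cliques-decomposition m k = record
  { nodes     = suc m
  ; tree      = starTree m
  ; isTree    = starTree-isTree m
  ; bag       = block k
  ; vertices  = λ v → quotient {suc m} k v , ∈-block⁺ {suc m} {k} v
  ; edges     = λ { {u} {v} (_ , eq) →
                  quotient {suc m} k u , ∈-block⁺ {suc m} {k} u ,
                  subst (λ i → v ∈ˢ block {suc m} k i) (sym eq) (∈-block⁺ {suc m} {k} v) }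
  -- Each vertex lies in exactly one bag, so both nodes coincide and the empty walk suffices.
  ; connected = λ v {x} {y} v∈x v∈y → subst (Star _ x)
                  (trans (sym (∈-block⁻ {suc m} {k} x v v∈x)) (∈-block⁻ {suc m} {k} y v v∈y)) ε
  }

cliques-treewidth : ∀ m τ → HasTreewidth (cliques {suc m} {suc τ}) τ
cliques-treewidth m τ =
  (D₀ , ℕ.≤-antisym (ℕ.∸-monoˡ-≤ 1 bags≤) (lower-bound D₀)) , lower-bound
  where
  D₀ : TreeDecomposition (cliques {suc m} {suc τ})
  D₀ = cliques-decomposition m (suc τ)

  bags≤ : max 0 (tabulate (λ (i : Fin (suc m)) → ∣ block (suc τ) i ∣)) ≤ suc τ
  bags≤ = max≤v⁺ z≤n (All.tabulate⁺ {f = ∣_∣ ∘ block {suc m} (suc τ)}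
    (λ i → ℕ.≤-reflexive (∣block∣≡k (suc τ) i)))

  lower-bound : (D : TreeDecomposition (cliques {suc m} {suc τ})) → τ ≤ width D
  -- The number of cliques is a successor, so there is a first one; its `τ + 1` vertices must share
  -- a bag.
  lower-bound D with clique⊆bag D (block {suc m} (suc τ) zero)
    (λ {u} {v} u∈ v∈ u≢v → u≢v ,
      trans (∈-block⁻ {suc m} {suc τ} zero u u∈) (sym (∈-block⁻ {suc m} {suc τ} zero v v∈)))
  ... | t , K⊆t = ℕ.≤-pred (begin
    suc τ                                      ≡⟨ ∣block∣≡k (suc τ) (zero {m}) ⟨
    ∣ block (suc τ) (zero {m}) ∣               ≤⟨ p⊆q⇒∣p∣≤∣q∣ K⊆t ⟩
    ∣ TreeDecomposition.bag D t ∣              ≤⟨ bag≤1+width D t ⟩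
    suc (width D)                              ∎)
    where open ℕ.≤-Reasoning

-- Voxels

neighbour : Fin 3 → Fin 2 → Voxel → Voxel
neighbour i zero    p = p [ i ]%= ℤ.pred
neighbour i (suc _) p = p [ i ]%= ℤ.suc

pred∘suc : ∀ i (p : Voxel) → p [ i ]%= ℤ.suc [ i ]%= ℤ.pred ≡ p
pred∘suc i p = trans (Vec.updateAt-updateAt i p) (Vec.updateAt-id-local i p (ℤ.pred-suc _))

-- A face is the lower face of the voxel at its corner and the upper face of the voxel one step
-- below along its axis.
face-owner : ∀ {f q} → f isFaceOf q → q ≡ proj₂ f ⊎ q ≡ proj₂ f [ proj₁ f ]%= ℤ.pred
face-owner (lower i q) = inj₁ refl
face-owner (upper i q) = inj₂ (sym (pred∘suc i q))

-- An element of `Fin 6` codes an axis and one of the two directions along it.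
neighbourᶜ : Voxel → Fin 6 → Voxel
neighbourᶜ p y = neighbour (quotient {3} 2 y) (remainder {3} 2 y) p

neighbourᶜ-combine : ∀ p i s → neighbourᶜ p (combine i s) ≡ neighbour i s p
neighbourᶜ-combine p i s = cong (λ (i , s) → neighbour i s p) (remQuot-combine {3} {2} i s)

-- One of the two owners of the shared face is `p`, which `p ≢ q` excludes for `q`; the other is a
-- grid neighbour of `p`.
adjacent⇒neighbour : ∀ {p q} → p adjacent q → ∃[ i ] ∃[ s ] q ≡ neighbour i s p
adjacent⇒neighbour (p≢q , (i , _) , lower i p , fq) with face-owner fq
... | inj₁ q≡p = contradiction (sym q≡p) p≢q
... | inj₂ eq  = i , zero , eq
adjacent⇒neighbour (p≢q , (i , _) , upper i p , fq) with face-owner fq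
... | inj₁ eq  = i , suc zero , eq
... | inj₂ eq  = contradiction (sym (trans eq (pred∘suc i p))) p≢q

module _ {n : ℕ} {G : Graph n} (R : VoxelRepresentation G) where
  open VoxelRepresentation R using (blob; disjoint; contacts)

  -- The index codes a voxel of the blob together with one of its six directions.
  voxel-across : ∀ v → Fin (length (voxels (blob v)) * 6) → Voxel
  voxel-across v x = neighbourᶜ
    (lookup (voxels (blob v)) (quotient 6 x))
    (remainder {length (voxels (blob v))} 6 x)

  adjacent-blob : ∀ {v w} → Adj G v w → ∃[ x ] voxel-across v x ∈ voxels (blob w)
  adjacent-blob {v} {w} vw
    with p , q , p∈ , q∈ , pq ← Equivalence.from (contacts (λ v≡w → Graph.irrefl G v≡w vw)) vw
    with i , s , q≡ ← adjacent⇒neighbour pq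
    = combine (index p∈) (combine i s) , subst (_∈ voxels (blob w)) (sym across≡q) q∈
    where
    open ≡-Reasoning
    across≡q : voxel-across v (combine (index p∈) (combine i s)) ≡ q
    across≡q = begin
      voxel-across v (combine (index p∈) (combine i s))
        ≡⟨ cong (λ (a , y) → neighbourᶜ (lookup (voxels (blob v)) a) y)
                (remQuot-combine (index p∈) (combine i s)) ⟩
      neighbourᶜ (lookup (voxels (blob v)) (index p∈)) (combine i s)
        ≡⟨ neighbourᶜ-combine _ i s ⟩
      neighbour i s (lookup (voxels (blob v)) (index p∈))
        ≡⟨ cong (neighbour i s) (lookup-index p∈) ⟨
      neighbour i s p
        ≡⟨ q≡ ⟨
      q ∎

  -- Each neighbour chooses a pair of voxel and direction that leads into its own blob. Disjointness
  -- of the blobs makes this choice injective.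
  degree≤6∣blob∣ : ∀ {d} v (g : Fin d → Fin n) → (∀ {i j} → g i ≡ g j → i ≡ j) →
                   (∀ j → Adj G v (g j)) → d ≤ length (voxels (blob v)) * 6
  degree≤6∣blob∣ v g g-injective adj = injective⇒≤ {f = proj₁ ∘ across} across-injective
    where
    across : ∀ j → ∃[ x ] voxel-across v x ∈ voxels (blob (g j))
    across j = adjacent-blob (adj j)

    across-injective : ∀ {i j} → proj₁ (across i) ≡ proj₁ (across j) → i ≡ j
    across-injective {i} {j} eq with g i ≟ g j
    ... | yes gi≡gj = g-injective gi≡gj
    ... | no  gi≢gj = ⊥-elim (disjoint gi≢gj
      (proj₂ (across i) ,
       subst (λ x → voxel-across v x ∈ voxels (blob (g j))) (sym eq) (proj₂ (across j))))

sum-lower-bound : ∀ {n} d c (f : Fin n → ℕ) → (∀ i → d ≤ f i * c) → n * d ≤ sum (tabulate f) * c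
sum-lower-bound {zero}  d c f d≤ = z≤n
sum-lower-bound {suc n} d c f d≤ = begin
  d + n * d                                 ≤⟨ ℕ.+-mono-≤ (d≤ zero) rest ⟩
  f zero * c + sum (tabulate (f ∘ suc)) * c ≡⟨ ℕ.*-distribʳ-+ c (f zero) _ ⟨
  (f zero + sum (tabulate (f ∘ suc))) * c     ∎
  where
  open ℕ.≤-Reasoning
  rest = sum-lower-bound d c (f ∘ suc) (d≤ ∘ suc)

cliques-size : ∀ {m τ} (R : VoxelRepresentation (cliques {m} {suc τ})) →
               m * suc τ * τ ≤ size R * 6
cliques-size {m} {τ} R = sum-lower-bound τ 6 _ (λ v →
  degree≤6∣blob∣ R v (clique-neighbour {m} v) (clique-neighbour-injective {m} v) (cliques-adj {m} v))

-- Passage to rational numbers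

toℚᵘ-fromℕ : ∀ k → ℚ.toℚᵘ (fromℕ k) ℚᵘ.≃ ℚᵘ.mkℚᵘ (ℤ.+ k) 0
toℚᵘ-fromℕ k = ℚ.toℚᵘ-fromℚᵘ (ℚᵘ.mkℚᵘ (ℤ.+ k) 0)

⅙ : ℚ
⅙ = ℤ.+ 1 ℚ./ 6

-- Unnormalised fractions keep the denominators 6 and 1 explicit, so cross-multiplication gives back
-- the hypothesis. `mkℚᵘ` stores the denominator minus one.
⅙*-≤ : ∀ {a b s} → a * b ≤ s * 6 → ⅙ ℚ.* fromℕ a ℚ.* fromℕ b ℚ.≤ fromℕ s
⅙*-≤ {a} {b} {s} ab≤6s = ℚ.toℚᵘ-cancel-≤ (begin
  ℚ.toℚᵘ (⅙ ℚ.* fromℕ a ℚ.* fromℕ b)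
    ≃⟨ ℚ.toℚᵘ-homo-* (⅙ ℚ.* fromℕ a) (fromℕ b) ⟩
  ℚ.toℚᵘ (⅙ ℚ.* fromℕ a) ℚᵘ.* ℚ.toℚᵘ (fromℕ b)
    ≃⟨ ℚᵘ.*-cong (ℚ.toℚᵘ-homo-* ⅙ (fromℕ a)) (toℚᵘ-fromℕ b) ⟩
  ℚ.toℚᵘ ⅙ ℚᵘ.* ℚ.toℚᵘ (fromℕ a) ℚᵘ.* ℚᵘ.mkℚᵘ (ℤ.+ b) 0
    ≃⟨ ℚᵘ.*-congʳ (ℚᵘ.*-congˡ (toℚᵘ-fromℕ a)) ⟩
  ℚᵘ.mkℚᵘ (ℤ.+ 1) 5 ℚᵘ.* ℚᵘ.mkℚᵘ (ℤ.+ a) 0 ℚᵘ.* ℚᵘ.mkℚᵘ (ℤ.+ b) 0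
    ≤⟨ ℚᵘ.*≤* cross-multiplied ⟩
  ℚᵘ.mkℚᵘ (ℤ.+ s) 0
    ≃⟨ toℚᵘ-fromℕ s ⟨
  ℚ.toℚᵘ (fromℕ s) ∎)
  where
  open ℚᵘ.≤-Reasoning
  cross-multiplied : (ℤ.+ 1 ℤ.* ℤ.+ a ℤ.* ℤ.+ b) ℤ.* ℤ.+ 1 ℤ.≤ ℤ.+ s ℤ.* ℤ.+ 6
  cross-multiplied
    rewrite ℤ.*-identityʳ (ℤ.+ 1 ℤ.* ℤ.+ a ℤ.* ℤ.+ b)
          | ℤ.*-identityˡ (ℤ.+ a)
          | sym (ℤ.pos-* a b)
          | sym (ℤ.pos-* s 6)
    = ℤ.+≤+ ab≤6s

theorem12 : ∃[ c ] 0ℚ ℚ.< c ×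
    (∀ (τ : ℕ) → 1 ≤ τ →
    ∀ (N : ℕ) → ∃[ n ] N ≤ n ×
    (Σ[ G ∈ Graph n ] HasTreewidth G τ ×
    (∀ (R : VoxelRepresentation G) → c ℚ.* fromℕ n ℚ.* fromℕ τ ℚ.≤ fromℕ (size R))))
theorem12 = ⅙ , ℚ.positive⁻¹ ⅙ , λ τ _ N →
  -- Taking `N + 1` cliques makes the graph large enough and guarantees at least one clique even for
  -- `N = 0`.
  suc N * suc τ , ℕ.≤-trans (ℕ.n≤1+n N) (ℕ.m≤m*n (suc N) (suc τ)) ,
  cliques {suc N} {suc τ} , cliques-treewidth N τ ,
  λ R → ⅙*-≤ {suc N * suc τ} {τ} {size R} (cliques-size {suc N} R)
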